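{- Every intermediate result $b$ in a normalized correct calculation DAG $D$ for the semigroup evaluation $r=\prod_{i=1}^N a_i$ represents a product $b=\prod_{i=j}^k a_i$ with $1\leq j\leq k\leq N$.
   Context: A program for computing $\prod_{i=1}^N a_i$ in a semigroup is a straight-line sequence of applications $z=x\cdot y$ of the (associative) semigroup operation to input values $a_1,\dots,a_N$ or previously computed intermediate results. Its calculation DAG has one vertex for each input value, each intermediate result and the output variable $r$; for each application $z=x\cdot y$ with operands represented by $v_x,v_y$ and result by $v_z$ there are directed edges $(v_x,v_z)$ and $(v_y,v_z)$. A variable $x$ is used for $y$ if there is a directed path from $v_x$ to $v_y$. The DAG is normalized if every vertex is used for the output vertex, and correct if, for every semigroup and every input values, the output variable equals $\prod_{i=1}^N a_i$. "Represents the product" means that, as a formal product of the inputs in order (i.e., in the free semigroup on $a_1,\dots,a_N$), $b$ equals $a_ja_{j+1}\cdots a_k$. -}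

module Defs where

open import Level using (0ℓ)
open import Data.Nat using (ℕ; zero; suc; _+_; _∸_)
open import Data.Fin using (Fin; zero; suc; toℕ)
open import Data.Sum using (_⊎_; inj₁; inj₂)
open import Data.Product using (_×_; _,_; Σ; ∃)
open import Data.List using (List; [_]; _++_; map; applyUpTo)
open import Algebra.Bundles using (Semigroup)
open import Relation.Binary.Construct.Closure.ReflexiveTransitive using (Star)

-- Intermediate results are indexed de Bruijn style: inj₂ zero is the most
-- recently computed result.
Var : ℕ → ℕ → Set
Var N m = Fin N ⊎ Fin m

weaken : ∀ {N m} → Var N m → Var N (suc m)
weaken (inj₁ i) = inj₁ i
weaken (inj₂ j) = inj₂ (suc j)

-- Straight-line program: a snoc-list of applications z = x · y, whose
-- operands are inputs or previously computed results.
data Prog (N : ℕ) : ℕ → Set where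
  []  : Prog N 0
  _▷_ : ∀ {m} → Prog N m → Var N m × Var N m → Prog N (suc m)

eval : ∀ {N m} {A : Set} → (A → A → A) → (Fin N → A) → Prog N m → Var N m → A
eval op a [] (inj₁ i) = a i
eval op a (p ▷ s) (inj₁ i) = eval op a p (inj₁ i)
eval op a (p ▷ (x , y)) (inj₂ zero) = op (eval op a p x) (eval op a p y)
eval op a (p ▷ s) (inj₂ (suc j)) = eval op a p (inj₂ j)

record Calc (N : ℕ) : Set where
  field
    steps : ℕ
    prog  : Prog N steps
    out   : Var N steps

-- Edges of the calculation DAG: (v_x, v_z) and (v_y, v_z) for z = x · y.
data Edge {N : ℕ} : ∀ {m} → Prog N m → Var N m → Var N m → Set where
  opˡ   : ∀ {m} {p : Prog N m} {x y} → Edge (p ▷ (x , y)) (weaken x) (inj₂ zero)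
  opʳ   : ∀ {m} {p : Prog N m} {x y} → Edge (p ▷ (x , y)) (weaken y) (inj₂ zero)
  there : ∀ {m} {p : Prog N m} {s u v} → Edge p u v → Edge (p ▷ s) (weaken u) (weaken v)

UsedFor : ∀ {N m} → Prog N m → Var N m → Var N m → Set
UsedFor p = Star (Edge p)

Normalized : ∀ {N} → Calc N → Set
Normalized C = ∀ v → UsedFor prog v out
  where open Calc C

prod : ∀ {n} {A : Set} → (A → A → A) → (Fin (suc n) → A) → A
prod {zero}  op a = a zero
prod {suc n} op a = op (a zero) (prod op (λ i → a (suc i)))

Correct : ∀ {n} → Calc (suc n) → Set₁
Correct {n} C = (S : Semigroup 0ℓ 0ℓ) (a : Fin (suc n) → Semigroup.Carrier S) →
  Semigroup._≈_ S (eval (Semigroup._∙_ S) a prog out) (prod (Semigroup._∙_ S) a)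
  where open Calc C

-- Formal product (word over the inputs) represented by a variable,
-- computed in the free semigroup (nonempty words under concatenation).
word : ∀ {N m} → Prog N m → Var N m → List (Fin N)
word p = eval _++_ [_] p

-- The index list j, j+1, ..., k (assuming j ≤ k).
interval : ℕ → ℕ → List ℕ
interval j k = applyUpTo (j +_) (suc (k ∸ j))

module Submission where

-- Read every variable as the formal product (word) it computes
-- in the free semigroup.  Along every edge z = x · y of the calculation DAG
-- the words of x and y are contiguous pieces (infixes) of the word of z, so
-- by induction along paths the word of any variable that is used for the
-- output is an infix of the word of the output.  Correctness, instantiated
-- with the free semigroup (lists under concatenation) and the generic
-- inputs a_i = [ i ], says that the output word is the run 0, 1, ..., n.
-- Finally, a nonempty infix of a run of consecutive numbers is itself a run
-- j, j+1, ..., k with j ≤ k inside the range, and every word is nonempty.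

open import Defs
open import Data.Nat using (ℕ; suc)
open import Data.Fin using (Fin; toℕ; _≤_)
open import Data.Sum using (inj₂)
open import Data.Product using (_×_; Σ)
open import Data.List using (map)
open import Relation.Binary.PropositionalEquality using (_≡_)

import Data.Nat as ℕ
import Data.Nat.Properties as ℕ
open import Data.Fin using (zero; suc; fromℕ<)
open import Data.Fin.Properties using (toℕ-fromℕ<)
open import Data.Sum using (inj₁)
open import Data.Product using (_,_; proj₂; ∃₂)
open import Data.List using (List; []; _∷_; _++_; [_]; length; applyUpTo)
open import Data.List.Properties
  using (++-assoc; ++-identityʳ; map-++; ∷-injective; length-map; length-++-≤ˡ; ++-semigroup)
open import Relation.Binary.PropositionalEquality
  using (refl; sym; trans; cong; cong₂; subst; subst₂; module ≡-Reasoning)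
open import Relation.Binary.Construct.Closure.ReflexiveTransitive using (ε; _◅_)

Infix : {A : Set} → List A → List A → Set
Infix u v = ∃₂ λ xs ys → v ≡ xs ++ (u ++ ys)

infix-refl : {A : Set} {u : List A} → Infix u u
infix-refl = [] , [] , sym (++-identityʳ _)

infix-trans : {A : Set} {u v w : List A} → Infix u v → Infix v w → Infix u w
infix-trans {u = u} (xs , ys , refl) (xs′ , ys′ , refl) =
  xs′ ++ xs , ys ++ ys′ , regroup
  where
  open ≡-Reasoning
  regroup : xs′ ++ ((xs ++ (u ++ ys)) ++ ys′) ≡ (xs′ ++ xs) ++ (u ++ (ys ++ ys′))
  regroup = begin
    xs′ ++ ((xs ++ (u ++ ys)) ++ ys′) ≡⟨ cong (xs′ ++_) (++-assoc xs (u ++ ys) ys′) ⟩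
    xs′ ++ (xs ++ ((u ++ ys) ++ ys′)) ≡⟨ cong (λ t → xs′ ++ (xs ++ t)) (++-assoc u ys ys′) ⟩
    xs′ ++ (xs ++ (u ++ (ys ++ ys′))) ≡⟨ sym (++-assoc xs′ xs (u ++ (ys ++ ys′))) ⟩
    (xs′ ++ xs) ++ (u ++ (ys ++ ys′)) ∎

infix-map : {A B : Set} (f : A → B) {u v : List A} → Infix u v → Infix (map f u) (map f v)
infix-map f {u} (xs , ys , refl) =
  map f xs , map f ys , trans (map-++ f xs (u ++ ys)) (cong (map f xs ++_) (map-++ f u ys))

run : ℕ → ℕ → List ℕ
run a ℕ.zero    = []
run a (ℕ.suc l) = a ∷ run (ℕ.suc a) l

-- The frozen interval j..k is the run starting at j of length k - j + 1;
-- the shifted form of the hypothesis is what makes the induction go through.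
applyUpTo-run : ∀ (f : ℕ → ℕ) a l → (∀ i → f i ≡ a ℕ.+ i) → applyUpTo f l ≡ run a l
applyUpTo-run f a ℕ.zero    f≗a+ = refl
applyUpTo-run f a (ℕ.suc l) f≗a+ =
  cong₂ _∷_ (trans (f≗a+ 0) (ℕ.+-identityʳ a))
    (applyUpTo-run (λ i → f (ℕ.suc i)) (ℕ.suc a) l
      (λ i → trans (f≗a+ (ℕ.suc i)) (ℕ.+-suc a i)))

run≡interval : ∀ j l → run j (suc l) ≡ interval j (j ℕ.+ l)
run≡interval j l = begin
  run j (suc l)                             ≡⟨ sym (applyUpTo-run (j ℕ.+_) j (suc l) (λ _ → refl)) ⟩
  applyUpTo (j ℕ.+_) (suc l)                ≡⟨ cong (λ t → applyUpTo (j ℕ.+_) (suc t)) (sym (ℕ.m+n∸m≡n j l)) ⟩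
  applyUpTo (j ℕ.+_) (suc (j ℕ.+ l ℕ.∸ j)) ∎
  where open ≡-Reasoning

prefix-run : ∀ (w ys : List ℕ) a L → w ++ ys ≡ run a L →
  (w ≡ run a (length w)) × (length w ℕ.≤ L)
prefix-run []      ys a L         eq = refl , ℕ.z≤n
prefix-run (x ∷ w) ys a ℕ.zero    ()
prefix-run (x ∷ w) ys a (ℕ.suc L) eq with ∷-injective eq
... | x≡a , rest with prefix-run w ys (ℕ.suc a) L rest
...   | w≡run , bound = cong₂ _∷_ x≡a w≡run , ℕ.s≤s bound

infix-run : ∀ (xs w ys : List ℕ) a L → xs ++ (w ++ ys) ≡ run a L →
  (w ≡ run (a ℕ.+ length xs) (length w)) × (length xs ℕ.+ length w ℕ.≤ L)
infix-run []       w ys a L         eq rewrite ℕ.+-identityʳ a = prefix-run w ys a L eq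
infix-run (x ∷ xs) w ys a ℕ.zero    ()
infix-run (x ∷ xs) w ys a (ℕ.suc L) eq
  with infix-run xs w ys (ℕ.suc a) L (proj₂ (∷-injective eq))
... | w≡run , bound =
  trans w≡run (cong (λ s → run s (length w)) (sym (ℕ.+-suc a (length xs)))) , ℕ.s≤s bound

run-as-interval : ∀ {N} m l → m ℕ.+ l ℕ.< N →
  Σ (Fin N) λ j → Σ (Fin N) λ k → (j ≤ k) × (run m (suc l) ≡ interval (toℕ j) (toℕ k))
run-as-interval m l k<N =
  fromℕ< j<N , fromℕ< k<N ,
  subst₂ ℕ._≤_ (sym (toℕ-fromℕ< j<N)) (sym (toℕ-fromℕ< k<N)) (ℕ.m≤m+n m l) ,
  trans (run≡interval m l)
    (sym (cong₂ interval (toℕ-fromℕ< j<N) (toℕ-fromℕ< k<N)))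
  where
  j<N : m ℕ.< _
  j<N = ℕ.≤-<-trans (ℕ.m≤m+n m l) k<N

infix-of-range : ∀ {N} (w : List ℕ) → 1 ℕ.≤ length w → Infix w (run 0 N) →
  Σ (Fin N) λ j → Σ (Fin N) λ k → (j ≤ k) × (w ≡ interval (toℕ j) (toℕ k))
infix-of-range []       ()
infix-of-range {N} (t ∷ ts) _ (xs , ys , range≡) with infix-run xs (t ∷ ts) ys 0 N (sym range≡)
... | w≡run , bound with run-as-interval (length xs) (length ts)
                           (subst (ℕ._≤ N) (ℕ.+-suc (length xs) (length ts)) bound)
...   | j , k , j≤k , run≡ = j , k , j≤k , trans w≡run run≡

word-weaken : ∀ {N m} (p : Prog N m) s (v : Var N m) → word (p ▷ s) (weaken v) ≡ word p v
word-weaken p s (inj₁ i) = refl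
word-weaken p s (inj₂ j) = refl

edge-infix : ∀ {N m} {p : Prog N m} {u v} → Edge p u v → Infix (word p u) (word p v)
edge-infix {p = p ▷ (x , y)} opˡ =
  [] , word p y , cong (_++ word p y) (sym (word-weaken p (x , y) x))
edge-infix {p = p ▷ (x , y)} opʳ =
  word p x , [] ,
  cong (word p x ++_) (sym (trans (++-identityʳ _) (word-weaken p (x , y) y)))
edge-infix {p = p ▷ s} (there {u = u} {v = v} e)
  rewrite word-weaken p s u | word-weaken p s v = edge-infix e

usedFor-infix : ∀ {N m} {p : Prog N m} {u v} → UsedFor p u v → Infix (word p u) (word p v)
usedFor-infix ε        = infix-refl
usedFor-infix (e ◅ es) = infix-trans (edge-infix e) (usedFor-infix es)

word-nonempty : ∀ {N m} (p : Prog N m) v → 1 ℕ.≤ length (word p v)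
word-nonempty []            (inj₁ i)       = ℕ.s≤s ℕ.z≤n
word-nonempty (p ▷ s)       (inj₁ i)       = word-nonempty p (inj₁ i)
word-nonempty (p ▷ (x , y)) (inj₂ zero)    =
  ℕ.≤-trans (word-nonempty p x) (length-++-≤ˡ (word p x))
word-nonempty (p ▷ s)       (inj₂ (suc j)) = word-nonempty p (inj₂ j)

prod-run : ∀ n (g : Fin (suc n) → ℕ) a → (∀ i → g i ≡ a ℕ.+ toℕ i) →
  prod _++_ (λ i → [ g i ]) ≡ run a (suc n)
prod-run ℕ.zero    g a g≗a+ = cong [_] (trans (g≗a+ zero) (ℕ.+-identityʳ a))
prod-run (ℕ.suc n) g a g≗a+ =
  cong₂ _∷_ (trans (g≗a+ zero) (ℕ.+-identityʳ a))
    (prod-run n (λ i → g (suc i)) (ℕ.suc a)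
      (λ i → trans (g≗a+ (suc i)) (ℕ.+-suc a (toℕ i))))

-- map is a semigroup homomorphism for concatenation, so it commutes with prod.
map-prod : ∀ {A B : Set} k (f : A → B) (a : Fin (suc k) → List A) →
  map f (prod _++_ a) ≡ prod _++_ (λ i → map f (a i))
map-prod ℕ.zero    f a = refl
map-prod (ℕ.suc k) f a =
  trans (map-++ f (a zero) (prod _++_ (λ i → a (suc i))))
        (cong (map f (a zero) ++_) (map-prod k f (λ i → a (suc i))))

indices : ∀ {N m} → Prog N m → Var N m → List ℕ
indices p v = map toℕ (word p v)

-- Correctness in the free semigroup on the inputs: the output is 0, ..., n.
output-indices : ∀ {n} (D : Calc (suc n)) → Correct D →
  indices (Calc.prog D) (Calc.out D) ≡ run 0 (suc n)
output-indices {n} D correct = begin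
  map toℕ (word prog out)               ≡⟨ cong (map toℕ) (correct (++-semigroup (Fin (suc n))) [_]) ⟩
  map toℕ (prod _++_ [_])               ≡⟨ map-prod n toℕ [_] ⟩
  prod {n} _++_ (λ i → [ toℕ i ])       ≡⟨ prod-run n toℕ 0 (λ _ → refl) ⟩
  run 0 (suc n)                         ∎
  where
  open Calc D
  open ≡-Reasoning

lemma9 : ∀ {n} (D : Calc (suc n)) → Normalized D → Correct D →
    (b : Fin (Calc.steps D)) →
    Σ (Fin (suc n)) (λ j → Σ (Fin (suc n)) (λ k →
      (j ≤ k) × (map toℕ (word (Calc.prog D) (inj₂ b)) ≡ interval (toℕ j) (toℕ k))))
lemma9 D normalized correct b =
  infix-of-range (indices prog (inj₂ b)) nonempty
    (subst (Infix (indices prog (inj₂ b))) (output-indices D correct)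
      (infix-map toℕ (usedFor-infix (normalized (inj₂ b)))))
  where
  open Calc D
  nonempty : 1 ℕ.≤ length (indices prog (inj₂ b))
  nonempty = subst (1 ℕ.≤_) (sym (length-map toℕ (word prog (inj₂ b))))
               (word-nonempty prog (inj₂ b))
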